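{- Let $G$ be a finite group and let $H$ be a non-trivial subgroup of $G$. Then $H$ is a perfect code of $G$ if and only if $H$ is an $(a,b)$-regular set of $G$ for every pair of integers $a,b$ with $0\leq a\leq |H|-1$ and $0\leq b\leq |H|$ such that $\gcd(2,|H|-1)$ divides $a$.
   Context: For a finite group $G$ and an inverse-closed subset $S$ of $G\setminus\{1\}$ (i.e. $s\in S$ implies $s^{ -1}\in S$), the Cayley graph $\mathrm{Cay}(G,S)$ is the simple graph with vertex set $G$ in which $x,y\in G$ are adjacent if and only if $yx^{ -1}\in S$. For non-negative integers $a,b$, a subset $C$ of the vertex set of a simple graph $\Gamma$ is an $(a,b)$-regular set in $\Gamma$ if every vertex of $C$ is adjacent to exactly $a$ vertices of $C$ and every vertex outside $C$ is adjacent to exactly $b$ vertices of $C$. A perfect code of $\Gamma$ is a $(0,1)$-regular set in $\Gamma$. A subset $C$ of $G$ is called an $(a,b)$-regular set of $G$ if it is an $(a,b)$-regular set in $\mathrm{Cay}(G,S)$ for some inverse-closed subset $S$ of $G\setminus\{1\}$ (where $S$ may depend on $a$ and $b$); it is called a perfect code of $G$ if it is a $(0,1)$-regular set of $G$. -}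

module Defs where

open import Algebra.Bundles using (Group)
import Algebra.Properties.Group as GroupProperties
open import Data.Bool.Base using (Bool; T)
open import Data.Bool.Properties using (T?)
open import Data.Fin.Base using (Fin)
open import Data.Nat.Base using (ℕ)
open import Data.Product.Base using (Σ-syntax; _×_; _,_)
open import Data.Vec.Base using (Vec; count; tabulate)
open import Function.Bundles using (Func; Inverse)
open import Level using (Level; 0ℓ; _⊔_; suc)
open import Relation.Binary.Bundles using (Setoid)
open import Relation.Binary.Core using (Rel)
open import Relation.Binary.Definitions
  using (Symmetric; Irreflexive; _Respects₂_) renaming (Decidable to Decidable₂)
open import Relation.Binary.PropositionalEquality.Core using (_≡_; subst)
open import Relation.Binary.PropositionalEquality.Properties using (setoid)
open import Relation.Nullary.Decidable.Core using (Dec; _×-dec_)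
open import Relation.Nullary.Negation.Core using (¬_)
open import Relation.Unary using (Pred; Decidable)

private
  variable
    c ℓ p : Level

-- Subsets are given by characteristic functions that respect the equality of
-- the ambient setoid.  On a finite set every classical subset is of this form.
Subset : Setoid c ℓ → Set (c ⊔ ℓ)
Subset X = Func X (setoid Bool)

module _ {X : Setoid c ℓ} where
  open Setoid X

  infix 4 _∈_ _∉_ _∈?_

  _∈_ : Carrier → Subset X → Set
  x ∈ A = T (Func.to A x)

  _∉_ : Carrier → Subset X → Set
  x ∉ A = ¬ (x ∈ A)

  _∈?_ : ∀ x (A : Subset X) → Dec (x ∈ A)
  x ∈? A = T? (Func.to A x)

  ∈-resp-≈ : ∀ (A : Subset X) {x y} → x ≈ y → x ∈ A → y ∈ A
  ∈-resp-≈ A x≈y = subst T (Func.cong A x≈y)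

record Finite (X : Setoid c ℓ) : Set (c ⊔ ℓ) where
  open Setoid X
  field
    size        : ℕ
    enumeration : Inverse X (setoid (Fin size))

  elements : Vec Carrier size
  elements = tabulate (Inverse.from enumeration)

  number : {P : Pred Carrier p} → Decidable P → ℕ
  number P? = count P? elements

  card : Subset X → ℕ
  card A = number (_∈? A)

record SimpleGraph (V : Setoid c ℓ) : Set (c ⊔ suc 0ℓ ⊔ ℓ) where
  open Setoid V
  field
    _~_      : Rel Carrier 0ℓ
    _~?_     : Decidable₂ _~_
    ~-resp-≈ : _~_ Respects₂ _≈_
    ~-sym    : Symmetric _~_
    ~-irrefl : Irreflexive _≈_ _~_

record IsRegularSet {V : Setoid c ℓ} (fin : Finite V) (Γ : SimpleGraph V)
                    (a b : ℕ) (C : Subset V) : Set c where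
  open Setoid V
  open SimpleGraph Γ
  open Finite fin

  neighboursIn : Carrier → ℕ
  neighboursIn x = number (λ y → (y ∈? C) ×-dec (x ~? y))

  field
    inside  : ∀ x → x ∈ C → neighboursIn x ≡ a
    outside : ∀ x → x ∉ C → neighboursIn x ≡ b

module _ (G : Group c ℓ) where
  open Group G using (Carrier; _≈_; _∙_; _⁻¹; ε) renaming (setoid to ⟨G⟩)
  private module G = Group G
  open GroupProperties G using (⁻¹-anti-homo-//)

  record IsSubgroup (H : Subset ⟨G⟩) : Set c where
    field
      ε-closed  : ε ∈ H
      ∙-closed  : ∀ {x y} → x ∈ H → y ∈ H → x ∙ y ∈ H
      ⁻¹-closed : ∀ {x} → x ∈ H → x ⁻¹ ∈ H

  NonTrivial : Subset ⟨G⟩ → Set (c ⊔ ℓ)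
  NonTrivial H = Σ[ x ∈ Carrier ] x ∈ H × ¬ (x ≈ ε)

  record ConnectionSet : Set (c ⊔ ℓ) where
    field
      S         : Subset ⟨G⟩
      ε∉S       : ε ∉ S
      ⁻¹-closed : ∀ {x} → x ∈ S → x ⁻¹ ∈ S

  Cay : ConnectionSet → SimpleGraph ⟨G⟩
  Cay 𝒮 = record
    { _~_      = λ x y → y ∙ x ⁻¹ ∈ S
    ; _~?_     = λ x y → y ∙ x ⁻¹ ∈? S
    ; ~-resp-≈ = (λ y≈z → ∈-resp-≈ S (G.∙-congʳ y≈z))
               , (λ x≈z → ∈-resp-≈ S (G.∙-congˡ (G.⁻¹-cong x≈z)))
    ; ~-sym    = λ {x} {y} yx⁻¹∈S →
                   ∈-resp-≈ S (⁻¹-anti-homo-// y x) (⁻¹-closed yx⁻¹∈S)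
    ; ~-irrefl = λ {x} {y} x≈y yx⁻¹∈S →
                   ε∉S (∈-resp-≈ S (G.trans (G.∙-congʳ (G.sym x≈y)) (G.inverseʳ x)) yx⁻¹∈S)
    }
    where open ConnectionSet 𝒮

  IsRegularSetOf : Finite ⟨G⟩ → ℕ → ℕ → Subset ⟨G⟩ → Set (c ⊔ ℓ)
  IsRegularSetOf fin a b C = Σ[ 𝒮 ∈ ConnectionSet ] IsRegularSet fin (Cay 𝒮) a b C

  IsPerfectCodeOf : Finite ⟨G⟩ → Subset ⟨G⟩ → Set (c ⊔ ℓ)
  IsPerfectCodeOf fin C = IsRegularSetOf fin 0 1 C

{-# OPTIONS --safe #-}

-- A connection set S makes H an (a,b)-regular set iff S meets H in a elements and every other
-- right coset of H in b elements.  Inside H ∖ {1} an inverse-closed set of size a exists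
-- because a is even or there is an involution.  Outside H the double cosets D = HgH are
-- handled one at a time, D together with D⁻¹.  Let k be the number of right cosets in D and m
-- the common size of the nonempty cells Hx ∩ yH within D, so that k m = |H|.  Numbering the
-- right cosets of D and of D⁻¹ by 0, …, k-1, place the cell of x in row i and column j, the
-- numbers of Hx and Hx⁻¹; inversion transposes.  It suffices to find a symmetric k × k matrix
-- with entries at most m and row sums b such that at each inverse-closed (hence diagonal) cell
-- the entry is even or the cell contains an involution.  With F(x) = ⌊(b+x)/k⌋ - ⌊x/k⌋,
-- Hermite's identity shows that F(1+i+j), and likewise F(i+j), is a symmetric matrix with row
-- sums b; if k and m are both even it can be modified to have an even diagonal.  If m is odd,
-- an inverse-closed cell has odd size and so contains an involution.  If k is odd and D = D⁻¹,
-- a perfect code's connection set meets D in an inverse-closed set of odd size k, so D contains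
-- an involution, and conjugating by elements of H yields one in every inverse-closed cell.

module Submission where

open import Defs
open import Algebra.Bundles using (Group)
open import Algebra.Core using (Op₁; Op₂)
import Algebra.Morphism.GroupMonomorphism as GroupMonomorphism
open import Algebra.Morphism.Structures using (IsGroupMonomorphism)
import Algebra.Properties.Group as GroupProperties
open import Algebra.Structures using (IsGroup)
open import Data.Bool.Base using (Bool; true; false; T; not; _∧_; _∨_; if_then_else_)
open import Data.Bool.Properties using (⇔→≡; T-≡; T-∧; T-∨; T?; ∨-comm; ∨-idem; ∧-identityʳ; ∧-zeroʳ; ∧-distribʳ-∨)
open import Data.Empty using (⊥-elim)
open import Data.Fin.Base using (Fin; zero; suc; toℕ)
open import Data.Fin.Permutation using (permutation)
open import Data.Fin.Properties using (toℕ-injective; toℕ<n)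
open import Data.Nat.Base
  using (ℕ; zero; suc; _+_; _*_; _∸_; _⊓_; _≤_; _<_; _≡ᵇ_; _<ᵇ_; z≤n; s≤s; z<s; s<s⁻¹; s≤s⁻¹; NonZero; >-nonZero)
open import Data.Nat.Divisibility
  using (_∣_; _∣?_; _∣0; divides; n∣m⇒m%n≡0; m∣m*n; ∣-refl; ∣-trans)
open import Data.Nat.DivMod
open import Data.Nat.GCD using (gcd; gcd-greatest)
open import Data.Nat.Properties
open import Data.Product.Base using (∃-syntax; _×_; _,_; proj₁; proj₂)
open import Data.Sum.Base using (_⊎_; inj₁; inj₂; [_,_]′)
open import Data.Unit.Base using (tt)
open import Data.Vec.Base using (count; tabulate)
open import Function.Base using (_∘_)
open import Function.Bundles using (_⇔_; mk⇔; Equivalence; Func; Inverse)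
open import Relation.Binary.Definitions using (tri<; tri≈; tri>)
open import Relation.Binary.PropositionalEquality
  using (_≡_; _≗_; refl; sym; trans; cong; cong₂; subst; subst₂; module ≡-Reasoning)
import Relation.Binary.Reasoning.Setoid as ≈-Reasoning
open import Relation.Nullary.Decidable.Core using (Dec; yes; no; does; _×-dec_)
open import Relation.Nullary.Negation.Core using (¬_; contradiction)
open import Relation.Unary using (Decidable; Pred)
open import Algebra.Properties.CommutativeMonoid.Sum +-0-commutativeMonoid
  using (sum; sum-syntax; sum-cong-≗; sum-permute; sum-replicate-zero; ∑-distrib-+; ∑-comm)

private
  variable
    n : ℕ

-- Parity identities and passage between booleans and propositions.

m+m≡2*m : ∀ m → m + m ≡ 2 * m
m+m≡2*m m = cong (m +_) (sym (+-identityʳ m))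

m+m≡m*2 : ∀ m → m + m ≡ m * 2
m+m≡m*2 m = trans (m+m≡2*m m) (*-comm 2 m)

n%2+n/2+n/2≡n : ∀ n → n % 2 + (n / 2 + n / 2) ≡ n
n%2+n/2+n/2≡n n = trans (cong (n % 2 +_) (m+m≡m*2 (n / 2))) (sym (m≡m%n+[m/n]*n n 2))

∧⁺ : ∀ {a b} → T a → T b → T (a ∧ b)
∧⁺ p q = Equivalence.from T-∧ (p , q)

∧⁻ : ∀ {a b} → T (a ∧ b) → T a × T b
∧⁻ = Equivalence.to T-∧

T⇒≡true : ∀ {a} → T a → a ≡ true
T⇒≡true = Equivalence.to T-≡

≡true⇒T : ∀ {a} → a ≡ true → T a
≡true⇒T = Equivalence.from T-≡

¬T⇒≡false : ∀ {a} → ¬ T a → a ≡ false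
¬T⇒≡false {false} _ = refl
¬T⇒≡false {true}  p = ⊥-elim (p tt)

∨⁺ˡ : ∀ {a b} → T a → T (a ∨ b)
∨⁺ˡ = Equivalence.from T-∨ ∘ inj₁

∨⁺ʳ : ∀ {a b} → T b → T (a ∨ b)
∨⁺ʳ {a} = Equivalence.from (T-∨ {a}) ∘ inj₂

∨⁻ : ∀ {a b} → T (a ∨ b) → T a ⊎ T b
∨⁻ = Equivalence.to T-∨

T-ext : ∀ {a b} → (T a → T b) → (T b → T a) → a ≡ b
T-ext f g = ⇔→≡ (mk⇔ (T⇒≡true ∘ f ∘ ≡true⇒T) (T⇒≡true ∘ g ∘ ≡true⇒T))

-- Cardinalities of boolean subsets of `Fin n` as sums of indicators.

χ : Bool → ℕ
χ b = if b then 1 else 0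

χ-∨ : ∀ {a b} → (T a → ¬ T b) → χ (a ∨ b) ≡ χ a + χ b
χ-∨ {false}         _  = refl
χ-∨ {true}  {false} _  = refl
χ-∨ {true}  {true}  ¬p = ⊥-elim (¬p tt tt)

infixr 7 _∩_

_∩_ : (A B : Fin n → Bool) → Fin n → Bool
(A ∩ B) x = A x ∧ B x

∩-congʳ : {A B C : Fin n → Bool} → (∀ x → T (A x) → B x ≡ C x) → A ∩ B ≗ A ∩ C
∩-congʳ {A = A} eq x with A x | eq x
... | false | _  = refl
... | true  | eq = eq tt

#_ : (Fin n → Bool) → ℕ
# A = sum (χ ∘ A)

#-cong : {A B : Fin n → Bool} → A ≗ B → # A ≡ # B
#-cong A≗B = sum-cong-≗ (cong χ ∘ A≗B)

#-permute : (f g : Fin n → Fin n) → (∀ x → f (g x) ≡ x) → (∀ x → g (f x) ≡ x) →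
            ∀ A → # A ≡ # (A ∘ f)
#-permute f g fg gf A = sum-permute (χ ∘ A) (permutation f g fg gf)

#-∅ : {A : Fin n → Bool} → (∀ x → ¬ T (A x)) → # A ≡ 0
#-∅ {n} A-empty = trans (#-cong (¬T⇒≡false ∘ A-empty)) (sum-replicate-zero n)

∈⇒0<# : (A : Fin n → Bool) (x : Fin n) → T (A x) → 0 < # A
∈⇒0<# A zero    Ax with true ← A zero = z<s
∈⇒0<# A (suc x) Ax = m≤n⇒m≤o+n (χ (A zero)) (∈⇒0<# (A ∘ suc) x Ax)

0<#⇒∈ : (A : Fin n → Bool) → 0 < # A → ∃[ x ] T (A x)
0<#⇒∈ {suc n} A 0<#A with A zero in eq
... | true  = zero , ≡true⇒T eq
... | false = let x , Ax = 0<#⇒∈ (A ∘ suc) 0<#A in suc x , Ax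

∑-const : ∀ k c → ∑[ j < k ] c ≡ k * c
∑-const zero    c = refl
∑-const (suc k) c = cong (c +_) (∑-const k c)

∑-indicator : ∀ {m k} → m < k → ∑[ j < k ] χ (m ≡ᵇ toℕ j) ≡ 1
∑-indicator {zero}  {suc k} _   = cong suc (sum-replicate-zero k)
∑-indicator {suc m} {suc k} m<k = ∑-indicator (s<s⁻¹ m<k)

-- Each member of `A` takes exactly one value of `g`; expanding its indicator over the values and
-- exchanging the two sums gives the count.
#-partition : ∀ {k} (A : Fin n → Bool) (g : Fin n → ℕ) → (∀ x → T (A x) → g x < k) →
              # A ≡ ∑[ j < k ] # (A ∩ λ x → g x ≡ᵇ toℕ j)
#-partition {k = k} A g g< = trans (sum-cong-≗ split) (∑-comm (λ x j → χ (A x ∧ (g x ≡ᵇ toℕ {k} j))))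
  where
  split : ∀ x → χ (A x) ≡ ∑[ j < k ] χ (A x ∧ (g x ≡ᵇ toℕ j))
  split x with A x | g< x
  ... | false | _   = sym (sum-replicate-zero k)
  ... | true  | gx< = sym (∑-indicator (gx< tt))

-- Ranks within a subset, initial segments and least elements.

rank : (Fin n → Bool) → Fin n → ℕ
rank A zero    = 0
rank A (suc x) = χ (A zero) + rank (A ∘ suc) x

rank-cong : {A B : Fin n → Bool} → A ≗ B → rank A ≗ rank B
rank-cong A≗B zero    = refl
rank-cong A≗B (suc x) = cong₂ _+_ (cong χ (A≗B zero)) (rank-cong (A≗B ∘ suc) x)

rank<# : (A : Fin n → Bool) (x : Fin n) → T (A x) → rank A x < # A
rank<# A zero    Ax with true ← A zero = z<s
rank<# A (suc x) Ax = +-monoʳ-< (χ (A zero)) (rank<# (A ∘ suc) x Ax)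

rank-injective : (A : Fin n → Bool) {x y : Fin n} → T (A x) → T (A y) →
                 rank A x ≡ rank A y → x ≡ y
rank-injective A {zero}  {zero}  _  _  _  = refl
rank-injective A {zero}  {suc y} Ax _  eq with true ← A zero = contradiction eq 0≢1+n
rank-injective A {suc x} {zero}  _  Ay eq with true ← A zero = contradiction eq 1+n≢0
rank-injective A {suc x} {suc y} Ax Ay eq =
  cong suc (rank-injective (A ∘ suc) Ax Ay (+-cancelˡ-≡ (χ (A zero)) _ _ eq))

rank-surjective : (A : Fin n → Bool) {i : ℕ} → i < # A → ∃[ x ] T (A x) × rank A x ≡ i
rank-surjective {suc n} A {i} i< with A zero in eq
... | false = let x , Ax , r = rank-surjective (A ∘ suc) i< in
              suc x , Ax , trans (cong (λ b → χ b + rank (A ∘ suc) x) eq) r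
rank-surjective {suc n} A {zero}  i< | true = zero , ≡true⇒T eq , refl
rank-surjective {suc n} A {suc i} i< | true =
  let x , Ax , r = rank-surjective (A ∘ suc) (s<s⁻¹ i<) in
  suc x , Ax , trans (cong (λ b → χ b + rank (A ∘ suc) x) eq) (cong suc r)

take : (Fin n → Bool) → ℕ → Fin n → Bool
take A s x = A x ∧ (rank A x <ᵇ s)

take-cong : {A B : Fin n → Bool} {s t : ℕ} → A ≗ B → s ≡ t → take A s ≗ take B t
take-cong A≗B s≡t x = cong₂ _∧_ (A≗B x) (cong₂ _<ᵇ_ (rank-cong A≗B x) s≡t)

#-take : (A : Fin n → Bool) {s : ℕ} → s ≤ # A → # (take A s) ≡ s
#-take {zero}  A z≤n = refl
#-take {suc n} A {s} s≤ with A zero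
... | false = #-take (A ∘ suc) s≤
#-take {suc n} A {zero}  s≤ | true = #-∅ {A = λ x → A (suc x) ∧ false} (λ x → proj₂ ∘ ∧⁻ {A (suc x)})
#-take {suc n} A {suc s} (s≤s s≤) | true = cong suc (#-take (A ∘ suc) s≤)

-- `d` both bounds the search and is its default. When `d` belongs to `A` the result is the true
-- minimum, hence independent of `d`; this gives cosets canonical representatives.
least : Fin n → (Fin n → Bool) → Fin n
least zero    A = zero
least (suc d) A = if A zero then zero else suc (least d (A ∘ suc))

least-∈ : (d : Fin n) (A : Fin n → Bool) → T (A d) → T (A (least d A))
least-∈ zero    A Ad = Ad
least-∈ (suc d) A Ad with A zero in eq
... | true  = ≡true⇒T eq
... | false = least-∈ d (A ∘ suc) Ad

least-unique : (d d′ : Fin n) {A B : Fin n → Bool} → A ≗ B → T (A d) → T (B d′) →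
               least d A ≡ least d′ B
least-unique zero    zero     A≗B Ad Bd′ = refl
least-unique zero    (suc d′) {A} {B} A≗B Ad Bd′ rewrite sym (A≗B zero) | T⇒≡true Ad = refl
least-unique (suc d) zero     {A} {B} A≗B Ad Bd′ rewrite A≗B zero | T⇒≡true Bd′ = refl
least-unique (suc d) (suc d′) {A} {B} A≗B Ad Bd′ rewrite A≗B zero with B zero
... | true  = refl
... | false = cong suc (least-unique d d′ (A≗B ∘ suc) Ad Bd′)

-- Subsets closed under an involution, and closed subsets of prescribed size.

module Involution (ι : Fin n → Fin n) (ι-involutive : ∀ x → ι (ι x) ≡ x) where

  Closed : (Fin n → Bool) → Set
  Closed A = ∀ x → T (A x) → T (A (ι x))

  closed-≡ : ∀ {A} → Closed A → ∀ x → A (ι x) ≡ A x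
  closed-≡ {A} A-closed x =
    T-ext (subst (T ∘ A) (ι-involutive x) ∘ A-closed (ι x)) (A-closed x)

  #-ι : ∀ A → # A ≡ # (A ∘ ι)
  #-ι = #-permute ι ι ι-involutive ι-involutive

  -- In a closed set, `ascending` keeps the smaller element of each two-element orbit, so it counts
  -- these orbits; `fixed` keeps the one-element orbits.
  ascending fixed : (Fin n → Bool) → Fin n → Bool
  ascending A x = A x ∧ (toℕ x <ᵇ toℕ (ι x))
  fixed     A x = A x ∧ (toℕ x ≡ᵇ toℕ (ι x))

  ascending⁻ : ∀ {A x} → T (ascending A x) → T (A x) × toℕ x < toℕ (ι x)
  ascending⁻ {A} {x} p = let Ax , q = ∧⁻ {A x} p in Ax , <ᵇ⇒< _ _ q

  ascending⁺ : ∀ {A x} → T (A x) → toℕ x < toℕ (ι x) → T (ascending A x)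
  ascending⁺ Ax lt = ∧⁺ Ax (<⇒<ᵇ lt)

  fixed⁻ : ∀ {A x} → T (fixed A x) → T (A x) × ι x ≡ x
  fixed⁻ {A} {x} p = let Ax , q = ∧⁻ {A x} p in
    Ax , sym (toℕ-injective (≡ᵇ⇒≡ _ _ q))

  fixed⁺ : ∀ {A x} → T (A x) → ι x ≡ x → T (fixed A x)
  fixed⁺ {A} {x} Ax eq = ∧⁺ Ax (≡⇒≡ᵇ (toℕ x) _ (cong toℕ (sym eq)))

  ascending-cong : ∀ {A B} → A ≗ B → ascending A ≗ ascending B
  ascending-cong A≗B x = cong (_∧ _) (A≗B x)

  fixed-cong : ∀ {A B} → A ≗ B → fixed A ≗ fixed B
  fixed-cong A≗B x = cong (_∧ _) (A≗B x)

  symmetrise : (P Q : Fin n → Bool) → Fin n → Bool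
  symmetrise P Q x = P x ∨ (P (ι x) ∨ Q x)

  module _ {P Q : Fin n → Bool} (P-asc : ∀ x → T (P x) → toℕ x < toℕ (ι x))
           (Q-fix : ∀ x → T (Q x) → ι x ≡ x) where

    symmetrise-closed : Closed (symmetrise P Q)
    symmetrise-closed x p with ∨⁻ {P x} p
    ... | inj₁ Px = ∨⁺ʳ {P (ι x)} (∨⁺ˡ (subst (T ∘ P) (sym (ι-involutive x)) Px))
    ... | inj₂ q with ∨⁻ {P (ι x)} q
    ...   | inj₁ Pιx = ∨⁺ˡ Pιx
    ...   | inj₂ Qx  = subst (T ∘ symmetrise P Q) (sym (Q-fix x Qx)) p

    #-symmetrise : # (symmetrise P Q) ≡ # P + # P + # Q
    #-symmetrise = begin
      # (symmetrise P Q)                          ≡⟨ sum-cong-≗ χ-parts ⟩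
      sum (λ x → χ (P x) + (χ (P (ι x)) + χ (Q x))) ≡⟨ ∑-distrib-+ (χ ∘ P) (λ x → χ (P (ι x)) + χ (Q x)) ⟩
      # P + sum (λ x → χ (P (ι x)) + χ (Q x))     ≡⟨ cong (# P +_) (∑-distrib-+ (χ ∘ P ∘ ι) (χ ∘ Q)) ⟩
      # P + (# (P ∘ ι) + # Q)                     ≡⟨ cong (λ t → # P + (t + # Q)) (#-ι P) ⟨
      # P + (# P + # Q)                           ≡⟨ +-assoc (# P) (# P) (# Q) ⟨
      # P + # P + # Q                             ∎
      where
      open ≡-Reasoning

      P-desc : ∀ x → T (P (ι x)) → toℕ (ι x) < toℕ x
      P-desc x = subst (λ y → toℕ (ι x) < toℕ y) (ι-involutive x) ∘ P-asc (ι x)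

      -- The parts are disjoint: `x` is below `ι x` on `P`, above it on the image of `P`, and equal
      -- to it on `Q`.
      χ-parts : ∀ x → χ (symmetrise P Q x) ≡ χ (P x) + (χ (P (ι x)) + χ (Q x))
      χ-parts x = trans
        (χ-∨ λ Px → [ <-asym (P-asc x Px) ∘ P-desc x
                    , (λ Qx → <-irrefl (cong toℕ (sym (Q-fix x Qx))) (P-asc x Px)) ]′ ∘ ∨⁻)
        (cong (χ (P x) +_) (χ-∨ λ Pιx Qx → <-irrefl (cong toℕ (Q-fix x Qx)) (P-desc x Pιx)))

  module _ {A : Fin n → Bool} (A-closed : Closed A) where

    #-closed : # A ≡ # (ascending A) + # (ascending A) + # (fixed A)
    #-closed = trans (#-cong λ x → T-ext (to x) (from x))
      (#-symmetrise (λ x → proj₂ ∘ ascending⁻ {A}) (λ x → proj₂ ∘ fixed⁻ {A}))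
      where
      to : ∀ x → T (A x) → T (symmetrise (ascending A) (fixed A) x)
      to x Ax with <-cmp (toℕ x) (toℕ (ι x))
      ... | tri< lt _ _ = ∨⁺ˡ (ascending⁺ {A} Ax lt)
      ... | tri≈ _ eq _ = ∨⁺ʳ {ascending A x} (∨⁺ʳ {ascending A (ι x)}
                            (fixed⁺ {A} Ax (sym (toℕ-injective eq))))
      ... | tri> _ _ gt = ∨⁺ʳ {ascending A x} (∨⁺ˡ (ascending⁺ {A} (A-closed x Ax)
                            (subst (λ y → toℕ (ι x) < toℕ y) (sym (ι-involutive x)) gt)))
      from : ∀ x → T (symmetrise (ascending A) (fixed A) x) → T (A x)
      from x = [ proj₁ ∘ ascending⁻ {A}
               , [ subst T (closed-≡ A-closed x) ∘ proj₁ ∘ ascending⁻ {A} , proj₁ ∘ fixed⁻ {A} ]′ ∘ ∨⁻ ]′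
               ∘ ∨⁻

    -- The two-element orbits contribute an even number, so the cardinality has the parity of the
    -- number of fixed points.
    odd⇒fixed : ¬ 2 ∣ # A → 0 < # (fixed A)
    odd⇒fixed odd with # (fixed A) in eq
    ... | suc _ = z<s
    ... | zero  = contradiction (subst (2 ∣_) (sym (trans #-closed even)) (m∣m*n (# (ascending A)))) odd
      where
      even : # (ascending A) + # (ascending A) + # (fixed A) ≡ 2 * # (ascending A)
      even = trans (cong (# (ascending A) + # (ascending A) +_) eq)
        (+-assoc (# (ascending A)) _ 0)

  -- Whole orbits are preferred, at most `s / 2` of them; fixed points only fill what remains.
  pairs singles : (Fin n → Bool) → ℕ → ℕ
  pairs   A s = s / 2 ⊓ # (ascending A)
  singles A s = s ∸ (pairs A s + pairs A s)

  select : (Fin n → Bool) → ℕ → Fin n → Bool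
  select A s = symmetrise (take (ascending A) (pairs A s)) (take (fixed A) (singles A s))

  pairs-cong : ∀ {A B s t} → A ≗ B → s ≡ t → pairs A s ≡ pairs B t
  pairs-cong A≗B s≡t = cong₂ _⊓_ (cong (_/ 2) s≡t) (#-cong (ascending-cong A≗B))

  -- Later every element selects from its own piece; extensionality ensures that elements of the
  -- same piece refer to the same selection.
  select-cong : ∀ {A B s t} → A ≗ B → s ≡ t → select A s ≗ select B t
  select-cong {A} {B} {s} {t} A≗B s≡t x = cong₂ _∨_ (as x) (cong₂ _∨_ (as (ι x)) (fs x))
    where
    ps : pairs A s ≡ pairs B t
    ps = pairs-cong A≗B s≡t
    as : take (ascending A) (pairs A s) ≗ take (ascending B) (pairs B t)
    as = take-cong (ascending-cong A≗B) ps
    fs : take (fixed A) (singles A s) ≗ take (fixed B) (singles B t)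
    fs = take-cong (fixed-cong A≗B) (cong₂ _∸_ s≡t (cong₂ _+_ ps ps))

  module _ (A : Fin n → Bool) (s : ℕ) where
    private
      P Q : Fin n → Bool
      P = take (ascending A) (pairs A s)
      Q = take (fixed A) (singles A s)

      P⊆ : ∀ x → T (P x) → T (A x) × toℕ x < toℕ (ι x)
      P⊆ x = ascending⁻ {A} ∘ proj₁ ∘ ∧⁻ {ascending A x}

      Q⊆ : ∀ x → T (Q x) → T (A x) × ι x ≡ x
      Q⊆ x = fixed⁻ {A} ∘ proj₁ ∘ ∧⁻ {fixed A x}

    select-closed : Closed (select A s)
    select-closed = symmetrise-closed (λ x → proj₂ ∘ P⊆ x) (λ x → proj₂ ∘ Q⊆ x)

    select-⊆ : Closed A → ∀ x → T (select A s x) → T (A x)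
    select-⊆ A-closed x =
      [ proj₁ ∘ P⊆ x , [ subst T (closed-≡ A-closed x) ∘ proj₁ ∘ P⊆ (ι x) , proj₁ ∘ Q⊆ x ]′ ∘ ∨⁻ ]′ ∘ ∨⁻

    -- If there are at least `s / 2` pairs, only the remainder `s % 2` must come from fixed points,
    -- one of which exists when `s` is odd. Otherwise all pairs are taken, and `s ≤ # A` leaves
    -- enough fixed points.
    #-select : Closed A → s ≤ # A → 2 ∣ s ⊎ 0 < # (fixed A) → # (select A s) ≡ s
    #-select A-closed s≤ even⊎fix = begin
      # (select A s)                        ≡⟨ #-symmetrise (λ x → proj₂ ∘ P⊆ x) (λ x → proj₂ ∘ Q⊆ x) ⟩
      # P + # P + # Q                       ≡⟨ cong₂ (λ p q → p + p + q)
                                                 (#-take (ascending A) (m⊓n≤n (s / 2) _))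
                                                 (#-take (fixed A) singles≤) ⟩
      pairs A s + pairs A s + singles A s   ≡⟨ m+[n∸m]≡n 2pairs≤s ⟩
      s                                     ∎
      where
      open ≡-Reasoning
      s≡ : s ≡ s % 2 + (s / 2 + s / 2)
      s≡ = sym (n%2+n/2+n/2≡n s)

      2pairs≤s : pairs A s + pairs A s ≤ s
      2pairs≤s = ≤-trans (+-mono-≤ (m⊓n≤m (s / 2) _) (m⊓n≤m (s / 2) _))
        (≤-trans (m≤n+m _ (s % 2)) (≤-reflexive (sym s≡)))

      remainder≤ : s % 2 ≤ # (fixed A)
      remainder≤ = [ (λ even → subst (_≤ # (fixed A)) (sym (n∣m⇒m%n≡0 s 2 even)) z≤n)
                   , ≤-trans (s≤s⁻¹ (m%n<n s 2)) ]′ even⊎fix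

      singles≤ : singles A s ≤ # (fixed A)
      singles≤ with ≤-total (s / 2) (# (ascending A))
      ... | inj₁ le rewrite m≤n⇒m⊓n≡m le =
        subst (_≤ # (fixed A)) (sym (trans (cong (_∸ (s / 2 + s / 2)) s≡) (m+n∸n≡m (s % 2) (s / 2 + s / 2)))) remainder≤
      ... | inj₂ ge rewrite m≥n⇒m⊓n≡n ge =
        m≤n+o⇒m∸n≤o s _ (≤-trans s≤ (≤-reflexive (#-closed A-closed)))

-- Hermite's identity and symmetric matrices with constant row sums.

∑-shift : ∀ k (f : ℕ → ℕ) → f 0 + ∑[ j < k ] f (suc (toℕ j)) ≡ ∑[ j < k ] f (toℕ j) + f k
∑-shift zero    f = +-identityʳ (f 0)
∑-shift (suc k) f = trans (cong (f 0 +_) (∑-shift k (f ∘ suc))) (sym (+-assoc (f 0) _ _))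

module _ (k : ℕ) .{{_ : NonZero k}} where

  [x+k]/k≡1+x/k : ∀ x → (x + k) / k ≡ suc (x / k)
  [x+k]/k≡1+x/k x = trans (+-distrib-/-∣ʳ x ∣-refl)
    (trans (cong (x / k +_) (n/n≡1 k)) (+-comm (x / k) 1))

  -- Raising `x` by one shifts the window of `k` summands: `x / k` leaves and `(x + k) / k`, larger
  -- by one, enters. At `x = 0` every summand vanishes.
  hermite : ∀ x → ∑[ j < k ] ((x + toℕ j) / k) ≡ x
  hermite zero    = trans (sum-cong-≗ {k} (λ j → m<n⇒m/n≡0 (toℕ<n j)))
    (sum-replicate-zero k)
  hermite (suc x) = +-cancelˡ-≡ (x / k) _ _ (begin
    x / k + ∑[ j < k ] ((suc x + toℕ j) / k)
      ≡⟨ cong₂ _+_ (cong (_/ k) (sym (+-identityʳ x)))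
                   (sum-cong-≗ {k} (λ j → cong (_/ k) (sym (+-suc x (toℕ j))))) ⟩
    (x + 0) / k + ∑[ j < k ] ((x + suc (toℕ j)) / k)
      ≡⟨ ∑-shift k (λ j → (x + j) / k) ⟩
    ∑[ j < k ] ((x + toℕ j) / k) + (x + k) / k
      ≡⟨ cong₂ _+_ (hermite x) ([x+k]/k≡1+x/k x) ⟩
    x + suc (x / k)
      ≡⟨ +-suc x _ ⟩
    suc x + x / k
      ≡⟨ +-comm (suc x) _ ⟩
    x / k + suc x ∎)
    where open ≡-Reasoning

  -- The function `F` of the overview: the number of multiples of `k` in the interval `(x, b + x]`.
  increment : ℕ → ℕ → ℕ
  increment b x = (b + x) / k ∸ x / k

  increment-+ : ∀ b x → increment b x + x / k ≡ (b + x) / k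
  increment-+ b x = m∸n+n≡m (/-monoˡ-≤ k (m≤n+m x b))

  -- The difference of Hermite's identity at `b + x` and at `x`.
  ∑-increment : ∀ b x → ∑[ j < k ] increment b (x + toℕ j) ≡ b
  ∑-increment b x = +-cancelʳ-≡ x _ _ (begin
    ∑[ j < k ] increment b (x + toℕ j) + x
      ≡⟨ cong (∑[ j < k ] increment b (x + toℕ j) +_) (hermite x) ⟨
    ∑[ j < k ] increment b (x + toℕ j) + ∑[ j < k ] ((x + toℕ j) / k)
      ≡⟨ ∑-distrib-+ {k} (λ j → increment b (x + toℕ j)) (λ j → (x + toℕ j) / k) ⟨
    ∑[ j < k ] (increment b (x + toℕ j) + (x + toℕ j) / k)
      ≡⟨ sum-cong-≗ {k} (λ j → trans (increment-+ b (x + toℕ j)) (cong (_/ k) (sym (+-assoc b x (toℕ j))))) ⟩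
    ∑[ j < k ] ((b + x + toℕ j) / k)
      ≡⟨ hermite (b + x) ⟩
    b + x ∎)
    where open ≡-Reasoning

  increment-≤ : ∀ {b m} x → b ≤ k * m → increment b x ≤ m
  increment-≤ {b} {m} x b≤km = m≤n+o⇒m∸n≤o _ _ (begin
    (b + x) / k       ≤⟨ /-monoˡ-≤ k (+-monoˡ-≤ x b≤km) ⟩
    (k * m + x) / k   ≡⟨ +-distrib-/-∣ˡ x (m∣m*n m) ⟩
    k * m / k + x / k ≡⟨ cong (_+ x / k) (trans (cong (_/ k) (*-comm k m)) (m*n/n≡m m k)) ⟩
    m + x / k         ≡⟨ +-comm m (x / k) ⟩
    x / k + m         ∎)
    where open ≤-Reasoning

  -- The interval `(x, suc b + x]` is split at `suc x`.
  increment-suc : ∀ b x → increment b (suc x) + increment 1 x ≡ increment (suc b) x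
  increment-suc b x = +-cancelʳ-≡ (x / k) _ _ (begin
    increment b (suc x) + increment 1 x + x / k   ≡⟨ +-assoc (increment b (suc x)) _ _ ⟩
    increment b (suc x) + (increment 1 x + x / k) ≡⟨ cong (increment b (suc x) +_) (increment-+ 1 x) ⟩
    increment b (suc x) + suc x / k               ≡⟨ increment-+ b (suc x) ⟩
    (b + suc x) / k                               ≡⟨ cong (_/ k) (+-suc b x) ⟩
    (suc b + x) / k                               ≡⟨ increment-+ (suc b) x ⟨
    increment (suc b) x + x / k                   ∎)
    where open ≡-Reasoning

-- Division by an even `k` factors through halving, and adding 0 or 1 to the even number `i + i`
-- does not change its half.
increment-even : ∀ k .{{_ : NonZero k}} → 2 ∣ k → ∀ {b} i → b < 2 → increment k b (i + i) ≡ 0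
increment-even (suc k) (divides q@(suc _) eq) {b} i b<2 = trans (cong (_∸ (i + i) / suc k) same) (n∸n≡0 ((i + i) / suc k))
  where
  open ≡-Reasoning
  half : ∀ {b} → b < 2 → (b + (i + i)) / 2 ≡ i
  half {b} b<2 = begin
    (b + (i + i)) / 2   ≡⟨ cong (λ t → (b + t) / 2) (m+m≡m*2 i) ⟩
    (b + i * 2) / 2     ≡⟨ +-distrib-/-∣ʳ b (divides i refl) ⟩
    b / 2 + i * 2 / 2   ≡⟨ cong₂ _+_ (m<n⇒m/n≡0 b<2) (m*n/n≡m i 2) ⟩
    i                   ∎
  by-halves : ∀ x → x / suc k ≡ x / 2 / q
  by-halves x = trans (/-congʳ {m = x} (trans eq (*-comm q 2))) (sym (m/n/o≡m/[n*o] x 2 q))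
  same : (b + (i + i)) / suc k ≡ (i + i) / suc k
  same = trans (by-halves (b + (i + i))) (trans (cong (_/ q) (trans (half b<2) (sym (half z<s)))) (sym (by-halves (i + i))))

bothEven? : ∀ k m → Dec (2 ∣ k × 2 ∣ m)
bothEven? k m = (2 ∣? k) ×-dec (2 ∣? m)

-- The matrix entry at (i , j) for x = i + j.  In the second case the odd row sum is corrected by
-- increment k 1 x, which is 1 exactly where k divides 1 + x: never on the diagonal for even k,
-- and, by increment-suc, without exceeding m when added to the first two terms.
entry : (k m b x : ℕ) → ℕ
entry zero      m b x = 0
entry k@(suc _) m b x with bothEven? k m
... | no  _ = increment k b x
... | yes _ = increment k (b / 2) (suc x) + increment k (b / 2) (suc x) + increment k (b % 2) x

∑-entry : ∀ k m b x → b ≤ k * m → ∑[ j < k ] entry k m b (x + toℕ j) ≡ b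
∑-entry zero      m b x z≤n = refl
∑-entry k@(suc _) m b x b≤km with bothEven? k m
... | no  _ = ∑-increment k b x
... | yes _ = begin
  ∑[ j < k ] (half (suc (x + toℕ j)) + half (suc (x + toℕ j)) + rest (x + toℕ j))
    ≡⟨ ∑-distrib-+ {k} (λ j → half (suc (x + toℕ j)) + half (suc (x + toℕ j))) (λ j → rest (x + toℕ j)) ⟩
  ∑[ j < k ] (half (suc (x + toℕ j)) + half (suc (x + toℕ j))) + ∑[ j < k ] rest (x + toℕ j)
    ≡⟨ cong₂ _+_ (∑-distrib-+ {k} (λ j → half (suc (x + toℕ j))) (λ j → half (suc (x + toℕ j))))
                 (∑-increment k (b % 2) x) ⟩
  ∑[ j < k ] half (suc (x + toℕ j)) + ∑[ j < k ] half (suc (x + toℕ j)) + b % 2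
    ≡⟨ cong (λ t → t + t + b % 2) (∑-increment k (b / 2) (suc x)) ⟩
  b / 2 + b / 2 + b % 2
    ≡⟨ trans (+-comm (b / 2 + b / 2) _) (n%2+n/2+n/2≡n b) ⟩
  b ∎
  where
  open ≡-Reasoning
  half rest : ℕ → ℕ
  half = increment k (b / 2)
  rest = increment k (b % 2)

entry-≤ : ∀ k m b x → b ≤ k * m → entry k m b x ≤ m
entry-≤ zero      m b x b≤km = z≤n
entry-≤ k@(suc _) m b x b≤km with bothEven? k m
... | no  _ = increment-≤ k x b≤km
... | yes (_ , divides m′ refl) = bound
  where
  open ≤-Reasoning
  b′ = b / 2
  km≡ : k * (m′ * 2) ≡ k * m′ * 2
  km≡ = sym (*-assoc k m′ 2)
  b′≤ : b′ ≤ k * m′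
  b′≤ = subst (b′ ≤_) (trans (cong (_/ 2) km≡) (m*n/n≡m (k * m′) 2)) (/-monoˡ-≤ 2 b≤km)
  bound : increment k b′ (suc x) + increment k b′ (suc x) + increment k (b % 2) x ≤ m′ * 2
  bound with b % 2 in eq | m%n<n b 2
  ... | zero  | _ = begin
    increment k b′ (suc x) + increment k b′ (suc x) + increment k 0 x
      ≡⟨ trans (cong (increment k b′ (suc x) + increment k b′ (suc x) +_) (n∸n≡0 (x / k)))
               (+-identityʳ _) ⟩
    increment k b′ (suc x) + increment k b′ (suc x)
      ≤⟨ +-mono-≤ (increment-≤ k (suc x) b′≤) (increment-≤ k (suc x) b′≤) ⟩
    m′ + m′ ≡⟨ m+m≡m*2 m′ ⟩
    m′ * 2  ∎
  ... | suc (suc _) | s≤s (s≤s ())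
  ... | suc zero | _ = begin
    increment k b′ (suc x) + increment k b′ (suc x) + increment k 1 x
      ≡⟨ trans (+-assoc (increment k b′ (suc x)) _ _)
               (cong (increment k b′ (suc x) +_) (increment-suc k b′ x)) ⟩
    increment k b′ (suc x) + increment k (suc b′) x
      ≤⟨ +-mono-≤ (increment-≤ k (suc x) b′≤) (increment-≤ k x b′<) ⟩
    m′ + m′ ≡⟨ m+m≡m*2 m′ ⟩
    m′ * 2  ∎
    where
    -- Here `b` is odd, so twice `b′` is strictly below `b`, while `k * m` is twice `k * m′`. This
    -- leaves room for raising one half from `b′` to `suc b′`.
    b′< : b′ < k * m′
    b′< = *-cancelʳ-< 2 b′ (k * m′) (begin
      suc (b′ * 2)      ≡⟨ cong (_+ b′ * 2) eq ⟨
      b % 2 + b′ * 2    ≡⟨ m≡m%n+[m/n]*n b 2 ⟨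
      b                 ≤⟨ b≤km ⟩
      k * (m′ * 2)      ≡⟨ km≡ ⟩
      k * m′ * 2        ∎)

entry-even : ∀ k m b i → 2 ∣ k → 2 ∣ m → 2 ∣ entry k m b (i + i)
entry-even zero      m b i 2∣k 2∣m = divides 0 refl
entry-even k@(suc _) m b i 2∣k 2∣m with bothEven? k m
... | no ¬p = contradiction (2∣k , 2∣m) ¬p
... | yes _ = subst (2 ∣_) (sym eq) (m∣m*n half)
  where
  half = increment k (b / 2) (suc (i + i))
  eq : half + half + increment k (b % 2) (i + i) ≡ 2 * half
  eq = trans (cong (half + half +_) (increment-even k 2∣k i (m%n<n b 2))) (+-assoc half half 0)

-- Right cosets, cells and double cosets of `H`.

module Cosets {n} {_∙_ : Op₂ (Fin n)} {ε : Fin n} {_⁻¹ : Op₁ (Fin n)} (isGroup : IsGroup _≡_ _∙_ ε _⁻¹)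
  (H : Fin n → Bool) (ε∈H : T (H ε)) (∙-closed : ∀ {x y} → T (H x) → T (H y) → T (H (x ∙ y)))
  (⁻¹-closed : ∀ {x} → T (H x) → T (H (x ⁻¹))) where

  private
    group : Group _ _
    group = record { isGroup = isGroup }

  open IsGroup isGroup using (assoc; identityʳ; inverseʳ)
  open GroupProperties group
    using (⁻¹-involutive; ⁻¹-anti-homo-∙; ε⁻¹≈ε; \\-leftDividesˡ; \\-leftDividesʳ; //-rightDividesˡ; //-rightDividesʳ)
  open Involution _⁻¹ ⁻¹-involutive public

  #-∙ˡ : ∀ g A → # A ≡ # (A ∘ (g ∙_))
  #-∙ˡ g = #-permute (g ∙_) ((g ⁻¹) ∙_) (\\-leftDividesˡ g) (\\-leftDividesʳ g)

  #-∙ʳ : ∀ g A → # A ≡ # (A ∘ (_∙ g))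
  #-∙ʳ g = #-permute (_∙ g) (_∙ (g ⁻¹)) (//-rightDividesˡ g) (//-rightDividesʳ g)

  -- The right coset H z.
  row : Fin n → Fin n → Bool
  row z w = H (w ∙ (z ⁻¹))

  row-refl : ∀ z → T (row z z)
  row-refl z = subst (T ∘ H) (sym (inverseʳ z)) ε∈H

  row-sym : ∀ {z w} → T (row z w) → T (row w z)
  row-sym {z} {w} zw = subst (T ∘ H)
    (trans (⁻¹-anti-homo-∙ w (z ⁻¹)) (cong (_∙ (w ⁻¹)) (⁻¹-involutive z))) (⁻¹-closed zw)

  row-trans : ∀ {x y z} → T (row x y) → T (row y z) → T (row x z)
  row-trans {x} {y} {z} xy yz = subst (T ∘ H)
    (trans (sym (assoc (z ∙ (y ⁻¹)) y (x ⁻¹))) (cong (_∙ (x ⁻¹)) (//-rightDividesˡ y z)))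
    (∙-closed yz xy)

  row-cong : ∀ {z w} → T (row z w) → row z ≗ row w
  row-cong zw x = T-ext (row-trans (row-sym zw)) (row-trans zw)

  row-∙ʳ : ∀ {z w} u → T (row z w) → T (row (z ∙ u) (w ∙ u))
  row-∙ʳ {z} {w} u = subst (T ∘ H) (sym (begin
    (w ∙ u) ∙ ((z ∙ u) ⁻¹)          ≡⟨ cong ((w ∙ u) ∙_) (⁻¹-anti-homo-∙ z u) ⟩
    (w ∙ u) ∙ ((u ⁻¹) ∙ (z ⁻¹))     ≡⟨ assoc (w ∙ u) (u ⁻¹) (z ⁻¹) ⟨
    ((w ∙ u) ∙ (u ⁻¹)) ∙ (z ⁻¹)     ≡⟨ cong (_∙ (z ⁻¹)) (//-rightDividesʳ u w) ⟩
    w ∙ (z ⁻¹)                      ∎))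
    where open ≡-Reasoning

  row-∙ˡ : ∀ {h} z → T (H h) → T (row z (h ∙ z))
  row-∙ˡ {h} z = subst (T ∘ H) (sym (//-rightDividesʳ z h))

  row-H : ∀ {z w} → T (row z w) → T (H z) → T (H w)
  row-H {z} {w} zw Hz = subst (T ∘ H) (//-rightDividesˡ z w) (∙-closed zw Hz)

  #-row : ∀ z → # (row z) ≡ # H
  #-row z = sym (#-∙ʳ (z ⁻¹) H)

  -- H z ∩ z H, since w⁻¹ ∈ H z⁻¹ iff w ∈ z H.
  cell : Fin n → Fin n → Bool
  cell z w = row z w ∧ row (z ⁻¹) (w ⁻¹)

  cell⁻ : ∀ {z w} → T (cell z w) → T (row z w) × T (row (z ⁻¹) (w ⁻¹))
  cell⁻ {z} {w} = ∧⁻ {row z w}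

  cell-refl : ∀ z → T (cell z z)
  cell-refl z = ∧⁺ (row-refl z) (row-refl (z ⁻¹))

  cell-sym : ∀ {z w} → T (cell z w) → T (cell w z)
  cell-sym zw = let r , c = cell⁻ zw in ∧⁺ (row-sym r) (row-sym c)

  cell-cong : ∀ {z w} → T (cell z w) → cell z ≗ cell w
  cell-cong zw x = let r , c = cell⁻ zw in cong₂ _∧_ (row-cong r x) (row-cong c (x ⁻¹))

  cell-trans : ∀ {x y z} → T (cell x y) → T (cell y z) → T (cell x z)
  cell-trans {z = z} xy = subst T (sym (cell-cong xy z))

  cell-⁻¹ : ∀ {z w} → T (cell z w) → T (cell (z ⁻¹) (w ⁻¹))
  cell-⁻¹ {z} {w} zw = let r , c = cell⁻ zw in
    ∧⁺ c (subst₂ (λ x y → T (row x y)) (sym (⁻¹-involutive z)) (sym (⁻¹-involutive w)) r)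

  cell-⁻¹′ : ∀ {z w} → T (cell (z ⁻¹) (w ⁻¹)) → T (cell z w)
  cell-⁻¹′ {z} {w} = subst₂ (λ x y → T (cell x y)) (⁻¹-involutive z) (⁻¹-involutive w) ∘ cell-⁻¹

  cell-⁻¹-≡ : ∀ z w → cell (z ⁻¹) (w ⁻¹) ≡ cell z w
  cell-⁻¹-≡ z w = T-ext (cell-⁻¹′ {z} {w}) (cell-⁻¹ {z} {w})

  mult : Fin n → ℕ
  mult z = # (cell z)

  mult-⁻¹ : ∀ z → mult (z ⁻¹) ≡ mult z
  mult-⁻¹ z = trans (#-ι (cell (z ⁻¹))) (#-cong (cell-⁻¹-≡ z))

  -- Left multiplication by `h = w z⁻¹`, an element of `H`, preserves the coset `H z` and carries
  -- `z H` to `w H`, so it maps the one cell onto the other.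
  mult-row : ∀ {z w} → T (row z w) → mult z ≡ mult w
  mult-row {z} {w} zw = sym (trans (#-∙ˡ h (cell w)) (#-cong λ u → cong₂ _∧_ (rows u) (columns u)))
    where
    h = w ∙ (z ⁻¹)
    rows : ∀ u → row w (h ∙ u) ≡ row z u
    rows u = trans (row-cong (row-sym zw) (h ∙ u))
      (T-ext (λ p → row-trans p (row-sym (row-∙ˡ u zw))) (λ p → row-trans p (row-∙ˡ u zw)))
    w⁻¹≡ : w ⁻¹ ≡ (z ⁻¹) ∙ (h ⁻¹)
    w⁻¹≡ = trans (cong _⁻¹ (sym (//-rightDividesˡ z w))) (⁻¹-anti-homo-∙ h z)
    columns : ∀ u → row (w ⁻¹) ((h ∙ u) ⁻¹) ≡ row (z ⁻¹) (u ⁻¹)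
    columns u = trans (cong₂ row w⁻¹≡ (⁻¹-anti-homo-∙ h u))
      (T-ext
        (subst₂ (λ x y → T (row x y)) (//-rightDividesˡ h (z ⁻¹)) (//-rightDividesˡ h (u ⁻¹)) ∘ row-∙ʳ h)
        (row-∙ʳ (h ⁻¹)))

  -- The double coset H z H.
  double : Fin n → Fin n → Bool
  double z w = 0 <ᵇ # (λ h → H h ∧ row z (w ∙ h))

  double⁺ : ∀ {z w} h → T (H h) → T (row z (w ∙ h)) → T (double z w)
  double⁺ h Hh r = <⇒<ᵇ (∈⇒0<# _ h (∧⁺ Hh r))

  double⁻ : ∀ {z w} → T (double z w) → ∃[ h ] T (H h) × T (row z (w ∙ h))
  double⁻ {z} {w} d = let h , p = 0<#⇒∈ (λ h → H h ∧ row z (w ∙ h)) (<ᵇ⇒< 0 _ d) in h , ∧⁻ {H h} p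

  row⇒double : ∀ {z w} → T (row z w) → T (double z w)
  row⇒double {z} {w} r = double⁺ ε ε∈H (subst (T ∘ row z) (sym (identityʳ w)) r)

  double-sym : ∀ {z w} → T (double z w) → T (double w z)
  double-sym {z} {w} d = let h , Hh , r = double⁻ d in
    double⁺ (h ⁻¹) (⁻¹-closed Hh)
      (subst (λ x → T (row x (z ∙ (h ⁻¹)))) (//-rightDividesʳ h w) (row-∙ʳ (h ⁻¹) (row-sym r)))

  double-trans : ∀ {x y z} → T (double x y) → T (double y z) → T (double x z)
  double-trans {x} {y} {z} xy yz =
    let h , Hh , r = double⁻ xy
        h′ , Hh′ , r′ = double⁻ yz in
    double⁺ (h′ ∙ h) (∙-closed Hh′ Hh)
      (row-trans r (subst (T ∘ row (y ∙ h)) (assoc z h′ h) (row-∙ʳ h r′)))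

  double-cong : ∀ {z w} → T (double z w) → double z ≗ double w
  double-cong zw x = T-ext (double-trans (double-sym zw)) (double-trans zw)

  double-⁻¹ : ∀ {z w} → T (double z w) → T (double (z ⁻¹) (w ⁻¹))
  double-⁻¹ {z} {w} d = let h , Hh , r = double⁻ d in
    -- `r` says that `w h z⁻¹` lies in `H`; multiplying `w⁻¹` by it on the right gives `h z⁻¹`, an
    -- element of `H z⁻¹`.
    double⁺ ((w ∙ h) ∙ (z ⁻¹)) r (subst (T ∘ row (z ⁻¹)) (sym (begin
      (w ⁻¹) ∙ ((w ∙ h) ∙ (z ⁻¹))   ≡⟨ cong ((w ⁻¹) ∙_) (assoc w h (z ⁻¹)) ⟩
      (w ⁻¹) ∙ (w ∙ (h ∙ (z ⁻¹)))   ≡⟨ \\-leftDividesʳ w _ ⟩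
      h ∙ (z ⁻¹)                    ∎)) (row-∙ˡ (z ⁻¹) Hh))
    where open ≡-Reasoning

  double-H : ∀ {z w} → T (double z w) → T (H w) → T (H z)
  double-H d Hw = let h , Hh , r = double⁻ d in row-H (row-sym r) (∙-closed Hw Hh)

  -- Numbering the right cosets inside a double coset.

  rep : Fin n → Fin n
  rep z = least z (row z)

  row-rep : ∀ z → T (row z (rep z))
  row-rep z = least-∈ z (row z) (row-refl z)

  rep-cong : ∀ {z w} → T (row z w) → rep z ≡ rep w
  rep-cong {z} {w} zw = least-unique z w (row-cong zw) (row-refl z) (row-refl w)

  -- Cosets are counted through their least elements, which are the fixed points of `rep`.
  reps : Fin n → Fin n → Bool
  reps z w = double z w ∧ (toℕ (rep w) ≡ᵇ toℕ w)

  reps-cong : ∀ {z w} → T (double z w) → reps z ≗ reps w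
  reps-cong zw x = cong (_∧ (toℕ (rep x) ≡ᵇ toℕ x)) (double-cong zw x)

  rep∈reps : ∀ z → T (reps z (rep z))
  rep∈reps z = ∧⁺ (row⇒double (row-rep z))
    (≡⇒≡ᵇ (toℕ (rep (rep z))) _ (cong toℕ (sym (rep-cong (row-rep z)))))

  -- The number of right cosets in H z H; idx z is the number of H z among them.
  width : Fin n → ℕ
  width z = # (reps z)

  idx : Fin n → ℕ
  idx z = rank (reps z) (rep z)

  width-cong : ∀ {z w} → T (double z w) → width z ≡ width w
  width-cong zw = #-cong (reps-cong zw)

  idx-cong : ∀ {z w} → T (row z w) → idx z ≡ idx w
  idx-cong {z} {w} zw =
    trans (rank-cong (reps-cong (row⇒double zw)) (rep z)) (cong (rank (reps w)) (rep-cong zw))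

  idx<width : ∀ z → idx z < width z
  idx<width z = rank<# (reps z) (rep z) (rep∈reps z)

  idx-injective : ∀ {z w} → T (double z w) → idx z ≡ idx w → T (row z w)
  idx-injective {z} {w} zw eq =
    row-trans (row-rep z) (subst (λ x → T (row x w)) (sym rep≡) (row-sym (row-rep w)))
    where
    rep≡ : rep z ≡ rep w
    rep≡ = rank-injective (reps z) (rep∈reps z) (subst T (sym (reps-cong zw (rep w))) (rep∈reps w))
      (trans eq (sym (rank-cong (reps-cong zw) (rep w))))

  idx-surjective : ∀ z {i} → i < width z → ∃[ w ] T (double z w) × idx w ≡ i
  idx-surjective z i< =
    let w , p , r = rank-surjective (reps z) i<
        zw , q = ∧⁻ {double z w} p
        rep≡ = toℕ-injective (≡ᵇ⇒≡ (toℕ (rep w)) (toℕ w) q)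
    in w , zw , trans (sym (rank-cong (reps-cong zw) (rep w))) (trans (cong (rank (reps z)) rep≡) r)

  -- Every row meets every column: a coset `H v` inside `H z⁻¹ H` contains `z⁻¹ h⁻¹` for some `h` in
  -- `H`, and this is the inverse of `h z`.
  column : ∀ z {j} → j < width (z ⁻¹) → ∃[ w ] T (row z w) × idx (w ⁻¹) ≡ j
  column z j< =
    let v , d , i = idx-surjective (z ⁻¹) j<
        h , Hh , r = double⁻ d
    in (h ∙ z) , row-∙ˡ z Hh , trans (idx-cong (subst (λ x → T (row x v)) (sym (⁻¹-anti-homo-∙ h z))
         (subst (T ∘ row ((z ⁻¹) ∙ (h ⁻¹))) (//-rightDividesʳ h v) (row-∙ʳ (h ⁻¹) r)))) i

  -- The row `H z` is the disjoint union of its cells, and these correspond to the right cosets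
  -- `H w⁻¹` in `H z⁻¹ H`.
  #-row-∩ : ∀ z (A : Fin n → Bool) (c : ℕ → ℕ) →
            (∀ w → T (row z w) → # (cell w ∩ A) ≡ c (idx (w ⁻¹))) →
            # (row z ∩ A) ≡ ∑[ j < width (z ⁻¹) ] c (toℕ j)
  #-row-∩ z A c #cell =
    trans (#-partition (row z ∩ A) (λ w → idx (w ⁻¹)) idx<) (sum-cong-≗ {width (z ⁻¹)} columns)
    where
    same-double : ∀ {w} → T (row z w) → T (double (z ⁻¹) (w ⁻¹))
    same-double = double-⁻¹ ∘ row⇒double
    idx< : ∀ w → T ((row z ∩ A) w) → idx (w ⁻¹) < width (z ⁻¹)
    idx< w p = subst (idx (w ⁻¹) <_)
      (sym (width-cong (same-double (proj₁ (∧⁻ {row z w} p))))) (idx<width (w ⁻¹))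
    columns : ∀ j → # ((row z ∩ A) ∩ λ w → idx (w ⁻¹) ≡ᵇ toℕ j) ≡ c (toℕ j)
    columns j = let v , zv , i = column z (toℕ<n j) in
      trans (#-cong {B = cell v ∩ A} (λ w → T-ext
        (λ p → let q , e = ∧⁻ {row z w ∧ A w} p
                   zw , Aw = ∧⁻ {row z w} q
                   vw = row-trans (row-sym zv) zw in
               ∧⁺ (∧⁺ vw (idx-injective (double-⁻¹ (row⇒double vw)) (trans i (sym (≡ᵇ⇒≡ _ _ e))))) Aw)
        (λ p → let q , Aw = ∧⁻ {cell v w} p ; vw , e = cell⁻ q in
               ∧⁺ (∧⁺ (row-trans zv vw) Aw) (≡⇒≡ᵇ (idx (w ⁻¹)) _ (trans (sym (idx-cong e)) i)))))
      (trans (#cell v zv) (cong c i))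

  -- The equation `k m = |H|` of the overview: a row has `|H|` elements, and all its cells have the
  -- same size by `mult-row`.
  width*mult : ∀ z → width (z ⁻¹) * mult z ≡ # H
  width*mult z = begin
    width (z ⁻¹) * mult z                ≡⟨ ∑-const (width (z ⁻¹)) (mult z) ⟨
    ∑[ j < width (z ⁻¹) ] mult z         ≡⟨ #-row-∩ z (λ _ → true) (λ _ → mult z)
                                              (λ w zw → trans (∩-true (cell w)) (sym (mult-row zw))) ⟨
    # (row z ∩ λ _ → true)               ≡⟨ ∩-true (row z) ⟩
    # (row z)                            ≡⟨ #-row z ⟩
    # H                                  ∎
    where
    open ≡-Reasoning
    ∩-true : ∀ A → # (A ∩ λ _ → true) ≡ # A
    ∩-true A = #-cong (∧-identityʳ ∘ A)

  -- Inversion exchanges left and right cosets, so the number of right cosets is compared through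
  -- `width*mult`, cancelling the common cell size.
  width-⁻¹ : ∀ z → width (z ⁻¹) ≡ width z
  width-⁻¹ z = *-cancelʳ-≡ _ _ (mult z) {{>-nonZero (∈⇒0<# (cell z) z (cell-refl z))}} (begin
    width (z ⁻¹) * mult z            ≡⟨ width*mult z ⟩
    # H                              ≡⟨ width*mult (z ⁻¹) ⟨
    width ((z ⁻¹) ⁻¹) * mult (z ⁻¹)  ≡⟨ cong₂ _*_ (cong width (⁻¹-involutive z)) (mult-⁻¹ z) ⟩
    width z * mult z                 ∎)
    where open ≡-Reasoning

  -- Inverse-closed cells and the choice of elements in each cell.

  diagonal : Fin n → Bool
  diagonal z = cell z (z ⁻¹)

  diagonal-⁻¹ : ∀ z → diagonal (z ⁻¹) ≡ diagonal z
  diagonal-⁻¹ z = cell-⁻¹-≡ z (z ⁻¹)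

  cell-diagonal : ∀ {z w} → T (cell z w) → T (diagonal z) → T (diagonal w)
  cell-diagonal zw d = cell-trans (cell-sym zw) (cell-trans d (cell-⁻¹ zw))

  -- Selecting from a cell and its inverse at once keeps the selection inverse-closed; when the
  -- two are disjoint, inversion splits the selection evenly, hence the doubled quota below.
  piece : Fin n → Fin n → Bool
  piece z w = cell z w ∨ cell (z ⁻¹) w

  piece-cong : ∀ {z w} → T (cell z w) → piece z ≗ piece w
  piece-cong zw x = cong₂ _∨_ (cell-cong zw x) (cell-cong (cell-⁻¹ zw) x)

  piece-⁻¹ : ∀ z → piece (z ⁻¹) ≗ piece z
  piece-⁻¹ z x = trans (cong (λ y → cell (z ⁻¹) x ∨ cell y x) (⁻¹-involutive z)) (∨-comm (cell (z ⁻¹) x) _)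

  piece-closed : ∀ z → Closed (piece z)
  piece-closed z x p =
    [ (λ zx → ∨⁺ʳ {cell z (x ⁻¹)} (cell-⁻¹ zx))
    , (λ zx → ∨⁺ˡ (subst (λ y → T (cell y (x ⁻¹))) (⁻¹-involutive z) (cell-⁻¹ zx)))
    ]′ (∨⁻ {cell z x} p)

  piece-diagonal : ∀ {z} → T (diagonal z) → piece z ≗ cell z
  piece-diagonal {z} d x = trans (cong (cell z x ∨_) (sym (cell-cong d x))) (∨-idem (cell z x))

  module _ (b : ℕ) where

    -- The matrix entry in row `idx z` and column `idx (z ⁻¹)`. It depends only on the sum of the
    -- indices, which inversion preserves.
    share : Fin n → ℕ
    share z = entry (width z) (mult z) b (idx z + idx (z ⁻¹))

    share-cong : ∀ {z w} → T (cell z w) → share z ≡ share w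
    share-cong {z} {w} zw = let r , c = cell⁻ zw in
      trans (cong₂ (λ k m → entry k m b (idx z + idx (z ⁻¹))) (width-cong (row⇒double r)) (mult-row r))
            (cong (entry (width w) (mult w) b) (cong₂ _+_ (idx-cong r) (idx-cong c)))

    share-⁻¹ : ∀ z → share (z ⁻¹) ≡ share z
    share-⁻¹ z = trans (cong₂ (λ k m → entry k m b (idx (z ⁻¹) + idx ((z ⁻¹) ⁻¹))) (width-⁻¹ z) (mult-⁻¹ z))
      (cong (entry (width z) (mult z) b) (trans (cong (λ y → idx (z ⁻¹) + idx y) (⁻¹-involutive z)) (+-comm (idx (z ⁻¹)) _)))

    quota : Fin n → ℕ
    quota z = if diagonal z then share z else share z + share z

    quota-cong : ∀ {z w} → T (cell z w) → quota z ≡ quota w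
    quota-cong zw = cong₂ (λ d s → if d then s else s + s)
      (T-ext (cell-diagonal zw) (cell-diagonal (cell-sym zw))) (share-cong zw)

    quota-⁻¹ : ∀ z → quota (z ⁻¹) ≡ quota z
    quota-⁻¹ z = cong₂ (λ d s → if d then s else s + s) (diagonal-⁻¹ z) (share-⁻¹ z)

    chosen : Fin n → Fin n → Bool
    chosen z = select (piece z) (quota z)

    chosen-⊆ : ∀ z x → T (chosen z x) → T (piece z x)
    chosen-⊆ z = select-⊆ (piece z) (quota z) (piece-closed z)

    -- The union of the selections over all pieces, written without choosing representatives: each
    -- `z` consults its own piece.
    regular : Fin n → Bool
    regular z = chosen z z

    regular-closed : Closed regular
    regular-closed z = subst T (sym (select-cong (piece-⁻¹ z) (quota-⁻¹ z) (z ⁻¹)))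
      ∘ select-closed (piece z) (quota z) z

    regular-chosen : ∀ z w → T (cell z w) → regular w ≡ chosen z w
    regular-chosen z w zw = sym (select-cong (piece-cong zw) (quota-cong zw) w)

    module _ (b≤#H : b ≤ # H) where
      b≤width*mult : ∀ z → b ≤ width z * mult z
      b≤width*mult z = subst (b ≤_) (trans (sym (width*mult z)) (cong (_* mult z) (width-⁻¹ z))) b≤#H

      share≤mult : ∀ z → share z ≤ mult z
      share≤mult z = entry-≤ (width z) (mult z) b (idx z + idx (z ⁻¹)) (b≤width*mult z)

      #-cell-chosen : ∀ z → (T (diagonal z) → 2 ∣ share z ⊎ 0 < # (fixed (cell z))) →
                      # (cell z ∩ chosen z) ≡ share z
      #-cell-chosen z feasible with T? (diagonal z)
      ... | yes d = begin
        # (cell z ∩ chosen z)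
          ≡⟨ #-cong (λ x → T-ext (proj₂ ∘ ∧⁻ {cell z x})
               (λ p → ∧⁺ (subst T (piece-diagonal d x) (chosen-⊆ z x p)) p)) ⟩
        # (chosen z)
          ≡⟨ cong (λ s → # (select (piece z) s)) quota≡ ⟩
        # (select (piece z) (share z))
          ≡⟨ #-select (piece z) (share z) (piece-closed z)
               (subst (share z ≤_) (#-cong (sym ∘ piece-diagonal d)) (share≤mult z))
               ([ inj₁ , inj₂ ∘ subst (0 <_) (#-cong (fixed-cong (sym ∘ piece-diagonal d))) ]′ (feasible d)) ⟩
        share z ∎
        where
        open ≡-Reasoning
        quota≡ : quota z ≡ share z
        quota≡ = cong (λ d → if d then share z else share z + share z) (T⇒≡true d)
      ... | no ¬d = halve (begin
        # (cell z ∩ chosen z) + # (cell z ∩ chosen z)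
          ≡⟨ cong (# (cell z ∩ chosen z) +_) mirror ⟩
        # (cell z ∩ chosen z) + # (cell (z ⁻¹) ∩ chosen z)
          ≡⟨ ∑-distrib-+ (χ ∘ (cell z ∩ chosen z)) _ ⟨
        sum (λ x → χ ((cell z ∩ chosen z) x) + χ ((cell (z ⁻¹) ∩ chosen z) x))
          ≡⟨ sum-cong-≗ (λ x → sym (χ-∨ λ p q →
               disjoint x (proj₁ (∧⁻ {cell z x} p)) (proj₁ (∧⁻ {cell (z ⁻¹) x} q)))) ⟩
        # (λ x → (cell z x ∧ chosen z x) ∨ (cell (z ⁻¹) x ∧ chosen z x))
          ≡⟨ #-cong (λ x → sym (∧-distribʳ-∨ (chosen z x) (cell z x) _)) ⟩
        # (piece z ∩ chosen z)
          ≡⟨ #-cong (λ x → T-ext (proj₂ ∘ ∧⁻ {piece z x}) (λ p → ∧⁺ (chosen-⊆ z x p) p)) ⟩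
        # (chosen z)
          ≡⟨ cong (λ s → # (select (piece z) s)) quota≡ ⟩
        # (select (piece z) (share z + share z))
          ≡⟨ #-select (piece z) (share z + share z) (piece-closed z)
               (subst (share z + share z ≤_) (sym #piece) (+-mono-≤ (share≤mult z) (share≤mult z)))
               -- The doubled quota is even, so no fixed point is called for.
               (inj₁ (subst (2 ∣_) (sym (m+m≡2*m (share z))) (m∣m*n (share z)))) ⟩
        share z + share z ∎)
        where
        open ≡-Reasoning
        halve : ∀ {x y} → x + x ≡ y + y → x ≡ y
        halve {x} {y} eq = *-cancelˡ-≡ x y 2 (trans (sym (m+m≡2*m x)) (trans eq (m+m≡2*m y)))
        quota≡ : quota z ≡ share z + share z
        quota≡ = cong (λ d → if d then share z else share z + share z) (¬T⇒≡false ¬d)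
        disjoint : ∀ x → T (cell z x) → ¬ T (cell (z ⁻¹) x)
        disjoint x p q = ¬d (cell-trans p (cell-sym q))
        #piece : # (piece z) ≡ mult z + mult z
        #piece = trans (sum-cong-≗ (λ x → χ-∨ (disjoint x))) (trans (∑-distrib-+ (χ ∘ cell z) (χ ∘ cell (z ⁻¹)))
          (cong (mult z +_) (mult-⁻¹ z)))
        mirror : # (cell z ∩ chosen z) ≡ # (cell (z ⁻¹) ∩ chosen z)
        mirror = sym (trans (#-ι (cell (z ⁻¹) ∩ chosen z)) (#-cong λ x → cong₂ _∧_ (cell-⁻¹-≡ z x)
          (closed-≡ (select-closed (piece z) (quota z)) x)))

      #-row-regular : ∀ z → (∀ w → T (row z w) → T (diagonal w) → 2 ∣ share w ⊎ 0 < # (fixed (cell w))) →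
                      # (row z ∩ regular) ≡ b
      #-row-regular z feasible = trans (#-row-∩ z regular (λ j → entry (width z) (mult z) b (idx z + j)) cells)
        (trans (cong (λ k → ∑[ j < k ] entry (width z) (mult z) b (idx z + toℕ j)) (width-⁻¹ z))
          (∑-entry (width z) (mult z) b (idx z) (b≤width*mult z)))
        where
        cells : ∀ w → T (row z w) → # (cell w ∩ regular) ≡ entry (width z) (mult z) b (idx z + idx (w ⁻¹))
        cells w zw = trans (#-cong (∩-congʳ (regular-chosen w))) (trans (#-cell-chosen w (feasible w zw))
          (trans (cong₂ (λ k m → entry k m b (idx w + idx (w ⁻¹)))
                        (sym (width-cong (row⇒double zw))) (sym (mult-row zw)))
            (cong (λ i → entry (width z) (mult z) b (i + idx (w ⁻¹))) (sym (idx-cong zw)))))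

  -- Involutions supplied by a perfect code.

  module _ (S₀ : Fin n → Bool) (S₀-closed : Closed S₀)
           (S₀-row : ∀ z → ¬ T (H z) → # (row z ∩ S₀) ≡ 1) where

    -- None of the `width z` right cosets in `H z H` is `H` itself, so each contains exactly one
    -- element of `S₀`.
    #-double-S₀ : ∀ z → ¬ T (H z) → # (double z ∩ S₀) ≡ width z
    #-double-S₀ z z∉H = begin
      # (double z ∩ S₀)
        ≡⟨ #-partition (double z ∩ S₀) idx (λ w p →
             subst (idx w <_) (sym (width-cong (proj₁ (∧⁻ {double z w} p)))) (idx<width w)) ⟩
      ∑[ j < width z ] # ((double z ∩ S₀) ∩ λ w → idx w ≡ᵇ toℕ j)
        ≡⟨ sum-cong-≗ {width z} rows ⟩
      ∑[ j < width z ] 1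
        ≡⟨ ∑-const (width z) 1 ⟩
      width z * 1
        ≡⟨ *-identityʳ (width z) ⟩
      width z ∎
      where
      open ≡-Reasoning
      rows : ∀ j → # ((double z ∩ S₀) ∩ λ w → idx w ≡ᵇ toℕ j) ≡ 1
      rows j = let v , zv , i = idx-surjective z (toℕ<n j) in
        trans (#-cong {B = row v ∩ S₀} (λ w → T-ext
          (λ p → let q , e = ∧⁻ {double z w ∧ S₀ w} p
                     zw , Sw = ∧⁻ {double z w} q in
            ∧⁺ (idx-injective (double-trans (double-sym zv) zw) (trans i (sym (≡ᵇ⇒≡ _ _ e)))) Sw)
          (λ p → let vw , Sw = ∧⁻ {row v w} p in
            ∧⁺ (∧⁺ (double-trans zv (row⇒double vw)) Sw) (≡⇒≡ᵇ (idx w) _ (trans (sym (idx-cong vw)) i)))))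
        (S₀-row v (λ v∈H → z∉H (double-H zv v∈H)))

    odd-width⇒fixed : ∀ z → ¬ T (H z) → T (diagonal z) → ¬ 2 ∣ width z → 0 < # (fixed (cell z))
    odd-width⇒fixed z z∉H d odd =
      let t , p      = 0<#⇒∈ (fixed (double z ∩ S₀)) (odd⇒fixed closed (odd ∘ subst (2 ∣_) (#-double-S₀ z z∉H)))
          q , t⁻¹≡t  = fixed⁻ {double z ∩ S₀} p
          h , Hh , r = double⁻ (proj₁ (∧⁻ {double z t} q))
          -- Since `t h` lies in `H z`, so does the conjugate `u`. Being its own inverse, `u` also
          -- has its inverse in `H z = H z⁻¹`, and hence lies in the cell of `z`.
          u          = (h ⁻¹) ∙ (t ∙ h)
          zu         = row-trans r (row-∙ˡ (t ∙ h) (⁻¹-closed Hh))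
          u⁻¹≡u      = trans (⁻¹-anti-homo-∙ (h ⁻¹) (t ∙ h))
                         (trans (cong₂ _∙_ (trans (⁻¹-anti-homo-∙ t h) (cong ((h ⁻¹) ∙_) t⁻¹≡t)) (⁻¹-involutive h))
                           (assoc (h ⁻¹) t h))
      in ∈⇒0<# (fixed (cell z)) u (fixed⁺ {cell z}
           (∧⁺ zu (subst (T ∘ row (z ⁻¹)) (sym u⁻¹≡u) (row-trans (row-sym (proj₁ (cell⁻ d))) zu))) u⁻¹≡u)
      where
      closed : Closed (double z ∩ S₀)
      closed w p = let zw , Sw = ∧⁻ {double z w} p in
        ∧⁺ (double-trans (row⇒double (proj₁ (cell⁻ d))) (double-⁻¹ zw)) (S₀-closed w Sw)

    feasible : ∀ b z → ¬ T (H z) → T (diagonal z) → 2 ∣ share b z ⊎ 0 < # (fixed (cell z))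
    feasible b z z∉H d with 2 ∣? width z | 2 ∣? mult z
    ... | no odd     | _          = inj₂ (odd-width⇒fixed z z∉H d odd)
    ... | yes _      | no odd     = inj₂ (odd⇒fixed (λ x zx → cell-trans d (cell-⁻¹ zx)) odd)
    -- In an inverse-closed cell `H z = H z⁻¹`, so the two indices agree and the entry lies on the
    -- diagonal.
    ... | yes 2∣width | yes 2∣mult = inj₁ (subst (λ i → 2 ∣ entry (width z) (mult z) b (idx z + i))
      (idx-cong (proj₁ (cell⁻ d))) (entry-even (width z) (mult z) b (idx z) 2∣width 2∣mult))

    regular-outside : ∀ {b} → b ≤ # H → ∀ z → ¬ T (H z) → # (row z ∩ regular b) ≡ b
    regular-outside {b} b≤ z z∉H = #-row-regular b b≤ z (λ w zw → feasible b w (z∉H ∘ row-H (row-sym zw)))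

  -- The substitution `y = w x` turns the neighbours of `x` in `H` into the elements of `S` in the
  -- coset `H x⁻¹`.
  #-neighbours : ∀ (S : Fin n → Bool) x → # (λ y → H y ∧ S (y ∙ (x ⁻¹))) ≡ # (row (x ⁻¹) ∩ S)
  #-neighbours S x = trans (#-∙ʳ x (λ y → H y ∧ S (y ∙ (x ⁻¹)))) (#-cong λ w →
    cong₂ (λ u v → H (w ∙ u) ∧ S v) (sym (⁻¹-involutive x)) (//-rightDividesʳ x w))

  -- The connection set, inside and outside `H`.

  punctured : Fin n → Bool
  punctured x = H x ∧ not (toℕ ε ≡ᵇ toℕ x)

  ε∉punctured : ¬ T (punctured ε)
  ε∉punctured p with toℕ ε ≡ᵇ toℕ ε | ≡⇒≡ᵇ (toℕ ε) (toℕ ε) refl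
  ... | true | _ = proj₂ (∧⁻ {H ε} p)

  punctured-closed : Closed punctured
  punctured-closed x p with Hx , x≢ε ← ∧⁻ {H x} p with toℕ ε ≡ᵇ toℕ (x ⁻¹) in eq
  ... | false = ∧⁺ (⁻¹-closed Hx) tt
  ... | true  = contradiction (subst (T ∘ punctured) x≡ε p) ε∉punctured
    where
    x≡ε : x ≡ ε
    x≡ε = trans (sym (⁻¹-involutive x))
      (trans (cong _⁻¹ (sym (toℕ-injective (≡ᵇ⇒≡ _ _ (≡true⇒T eq))))) ε⁻¹≈ε)

  #-punctured : # punctured ≡ # H ∸ 1
  #-punctured = sym (cong (_∸ 1) (begin
    # H
      ≡⟨ sum-cong-≗ split ⟩
    ∑[ x < n ] (χ (toℕ ε ≡ᵇ toℕ x) + χ (punctured x))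
      ≡⟨ ∑-distrib-+ {n} (λ x → χ (toℕ ε ≡ᵇ toℕ x)) (χ ∘ punctured) ⟩
    ∑[ x < n ] χ (toℕ ε ≡ᵇ toℕ x) + # punctured
      ≡⟨ cong (_+ # punctured) (∑-indicator (toℕ<n ε)) ⟩
    suc (# punctured) ∎))
    where
    open ≡-Reasoning
    split : ∀ x → χ (H x) ≡ χ (toℕ ε ≡ᵇ toℕ x) + χ (punctured x)
    split x with toℕ ε ≡ᵇ toℕ x in eq
    ... | false = cong χ (sym (∧-identityʳ (H x)))
    ... | true  = trans (cong χ (T⇒≡true (subst (T ∘ H) (toℕ-injective (≡ᵇ⇒≡ _ _ (≡true⇒T eq))) ε∈H)))
                        (cong (suc ∘ χ) (sym (∧-zeroʳ (H x))))

  connection : (a b : ℕ) → Fin n → Bool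
  connection a b x = if H x then select punctured a x else regular b x

  module _ (a b : ℕ) where

    connection-∈ : ∀ {x} → T (H x) → connection a b x ≡ select punctured a x
    connection-∈ {x} Hx = cong (λ h → if h then select punctured a x else regular b x) (T⇒≡true Hx)

    connection-∉ : ∀ {x} → ¬ T (H x) → connection a b x ≡ regular b x
    connection-∉ {x} ¬Hx = cong (λ h → if h then select punctured a x else regular b x) (¬T⇒≡false ¬Hx)

    ε∉connection : ¬ T (connection a b ε)
    ε∉connection p = ε∉punctured (select-⊆ punctured a punctured-closed ε (subst T (connection-∈ ε∈H) p))

    connection-closed : Closed (connection a b)
    connection-closed x p with T? (H x)
    ... | yes Hx = subst T (sym (connection-∈ (⁻¹-closed Hx)))
                     (select-closed punctured a x (subst T (connection-∈ Hx) p))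
    ... | no ¬Hx = subst T (sym (connection-∉ (¬Hx ∘ subst (T ∘ H) (⁻¹-involutive x) ∘ ⁻¹-closed)))
                     (regular-closed b x (subst T (connection-∉ ¬Hx) p))

    connection-inside : a ≤ # H ∸ 1 → gcd 2 (# H ∸ 1) ∣ a →
                        ∀ z → T (H z) → # (row z ∩ connection a b) ≡ a
    connection-inside a≤ g∣a z Hz = trans (#-cong (λ x → T-ext
        (λ p → let zx , q = ∧⁻ {row z x} p in subst T (connection-∈ (row-H zx Hz)) q)
        (λ p → let Hx = proj₁ (∧⁻ {H x} (select-⊆ punctured a punctured-closed x p)) in
          ∧⁺ (∙-closed Hx (⁻¹-closed Hz)) (subst T (sym (connection-∈ Hx)) p))))
      (#-select punctured a punctured-closed (subst (a ≤_) (sym #-punctured) a≤) even⊎fixed)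
      where
      -- If `|H| - 1` is even, 2 divides the gcd and so `a`; if it is odd, `H` without the identity
      -- contains an involution.
      even⊎fixed : 2 ∣ a ⊎ 0 < # (fixed punctured)
      even⊎fixed with 2 ∣? # punctured
      ... | yes even = inj₁ (∣-trans (gcd-greatest ∣-refl (subst (2 ∣_) #-punctured even)) g∣a)
      ... | no  odd  = inj₂ (odd⇒fixed punctured-closed odd)

    connection-outside : ∀ z → ¬ T (H z) → # (row z ∩ connection a b) ≡ # (row z ∩ regular b)
    connection-outside z z∉H = #-cong (∩-congʳ {A = row z} λ x zx → connection-∉ {x} (z∉H ∘ row-H (row-sym zx)))

-- Transport between a finite group and its enumeration.

count-tabulate : ∀ {a p n} {A : Set a} {P : Pred A p} (P? : Decidable P) (f : Fin n → A) →
                 count P? (tabulate f) ≡ # (λ i → does (P? (f i)))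
count-tabulate {n = zero}  P? f = refl
count-tabulate {n = suc n} P? f with does (P? (f zero))
... | true  = cong suc (count-tabulate P? (f ∘ suc))
... | false = count-tabulate P? (f ∘ suc)

module Numbering {c ℓ} (G : Group c ℓ) (fin : Finite (Group.setoid G)) where
  open Group G using (Carrier; _≈_; _∙_; ε; _⁻¹; ∙-congˡ; ⁻¹-cong; setoid; rawGroup; isGroup)
    renaming (sym to ≈-sym)
  open Finite fin
  open Inverse enumeration using (to; from; to-cong; from-cong)
    renaming (strictlyInverseˡ to to∘from; strictlyInverseʳ to from∘to)

  infixl 7 _·_
  infix 8 _⁻¹′

  _·_ : Op₂ (Fin size)
  i · j = to (from i ∙ from j)

  1# : Fin size
  1# = to ε

  _⁻¹′ : Op₁ (Fin size)
  i ⁻¹′ = to (from i ⁻¹)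

  -- The group laws on `Fin size` are inherited from `G` along the injective homomorphism `from`,
  -- with propositional equality in place of the setoid equality.
  from-isMonomorphism : IsGroupMonomorphism
    (record { Carrier = Fin size ; _≈_ = _≡_ ; _∙_ = _·_ ; ε = 1# ; _⁻¹ = _⁻¹′ }) rawGroup from
  from-isMonomorphism = record
    { isGroupHomomorphism = record
      { isMonoidHomomorphism = record
        { isMagmaHomomorphism = record
          { isRelHomomorphism = record { cong = from-cong }
          ; homo = λ i j → from∘to _
          }
        ; ε-homo = from∘to _
        }
      ; ⁻¹-homo = λ i → from∘to _
      }
    ; injective = λ {i} {j} eq → trans (sym (to∘from i)) (trans (to-cong eq) (to∘from j))
    }

  ·-isGroup : IsGroup _≡_ _·_ 1# _⁻¹′
  ·-isGroup = GroupMonomorphism.isGroup from-isMonomorphism isGroup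

  ·-group : Group _ _
  ·-group = record { isGroup = ·-isGroup }

  open GroupProperties ·-group using (⁻¹-involutive)

  from-// : ∀ i x → from i ∙ x ⁻¹ ≈ from (i · to x ⁻¹′)
  from-// i x = begin
    from i ∙ x ⁻¹               ≈⟨ ∙-congˡ (⁻¹-cong (from∘to x)) ⟨
    from i ∙ from (to x) ⁻¹     ≈⟨ ∙-congˡ (from∘to _) ⟨
    from i ∙ from (to x ⁻¹′)    ≈⟨ from∘to _ ⟨
    from (i · to x ⁻¹′)         ∎
    where open ≈-Reasoning setoid

  restrict : Subset setoid → Fin size → Bool
  restrict A = Func.to A ∘ from

  ∈⇒restrict : ∀ A {x} → x ∈ A → T (restrict A (to x))
  ∈⇒restrict A {x} = ∈-resp-≈ A (≈-sym (from∘to x))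

  restrict⇒∈ : ∀ A {x} → T (restrict A (to x)) → x ∈ A
  restrict⇒∈ A {x} = ∈-resp-≈ A (from∘to x)

  extend : (Fin size → Bool) → Subset setoid
  extend A = record { to = A ∘ to ; cong = λ eq → cong A (to-cong eq) }

  restrict-extend : ∀ A → restrict (extend A) ≗ A
  restrict-extend A i = cong A (to∘from i)

  card≡# : ∀ A → card A ≡ # (restrict A)
  card≡# A = count-tabulate (_∈? A) from

  module _ (H : Subset setoid) (H-subgroup : IsSubgroup G H) where
    open IsSubgroup H-subgroup

    restrict-∙-closed : ∀ {i j} → T (restrict H i) → T (restrict H j) → T (restrict H (i · j))
    restrict-∙-closed p q = ∈⇒restrict H (∙-closed p q)

    restrict-⁻¹-closed : ∀ {i} → T (restrict H i) → T (restrict H (i ⁻¹′))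
    restrict-⁻¹-closed p = ∈⇒restrict H (⁻¹-closed p)

    open Cosets ·-isGroup (restrict H) (∈⇒restrict H ε-closed) restrict-∙-closed restrict-⁻¹-closed
      using (row; Closed; #-neighbours; connection; ε∉connection; connection-closed;
             connection-inside; connection-outside; regular-outside)

    open ConnectionSet using (S) renaming (⁻¹-closed to S-⁻¹-closed)

    #-neighboursIn : ∀ (𝒮 : ConnectionSet G) x →
                     number (λ y → (y ∈? H) ×-dec (y ∙ x ⁻¹ ∈? S 𝒮)) ≡ # (row (to x ⁻¹′) ∩ restrict (S 𝒮))
    #-neighboursIn 𝒮 x = trans (count-tabulate (λ y → (y ∈? H) ×-dec (y ∙ x ⁻¹ ∈? S 𝒮)) from)
      (trans (#-cong (λ i → cong (restrict H i ∧_) (Func.cong (S 𝒮) (from-// i x))))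
               (#-neighbours (restrict (S 𝒮)) (to x)))

    perfect-row : ((𝒮 , _) : IsPerfectCodeOf G fin H) →
                  ∀ z → ¬ T (restrict H z) → # (row z ∩ restrict (S 𝒮)) ≡ 1
    perfect-row (𝒮 , reg) z z∉H = subst (λ w → # (row w ∩ restrict (S 𝒮)) ≡ 1) x⁻¹≡z
      (trans (sym (#-neighboursIn 𝒮 x)) (outside x x∉H))
      where
      open IsRegularSet reg
      x : Carrier
      -- The neighbours of `x` in `H` correspond to the elements of the connection set in the coset
      -- of the inverse of `x`, so `x` is taken to be the inverse of `z`.
      x = from (z ⁻¹′)
      x⁻¹≡z : to x ⁻¹′ ≡ z
      x⁻¹≡z = trans (cong _⁻¹′ (to∘from (z ⁻¹′))) (⁻¹-involutive z)
      x∉H : x ∉ H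
      x∉H x∈H = z∉H (subst (T ∘ restrict H) x⁻¹≡z (∈⇒restrict H
        (⁻¹-closed (∈-resp-≈ H (≈-sym (from∘to x)) x∈H))))

    connectionSet : ℕ → ℕ → ConnectionSet G
    connectionSet a b = record
      { S         = extend (connection a b)
      ; ε∉S       = ε∉connection a b
      ; ⁻¹-closed = λ {x} p → subst (T ∘ connection a b) (to-cong (⁻¹-cong (from∘to x)))
                               (connection-closed a b (to x) p)
      }

    connectionSet-row : ∀ a b z → # (row z ∩ restrict (S (connectionSet a b))) ≡ # (row z ∩ connection a b)
    connectionSet-row a b z = #-cong (∩-congʳ {A = row z} λ i _ → restrict-extend (connection a b) i)

    perfect⇒regular : IsPerfectCodeOf G fin H → ∀ a b → a ≤ card H ∸ 1 → b ≤ card H →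
                      gcd 2 (card H ∸ 1) ∣ a → IsRegularSetOf G fin a b H
    perfect⇒regular code@(𝒮₀ , _) a b a≤ b≤ g∣a = connectionSet a b , record
      { inside  = λ x x∈H → trans (neighbours x) (connection-inside a b
          (subst (λ h → a ≤ h ∸ 1) (card≡# H) a≤) (subst (λ h → gcd 2 (h ∸ 1) ∣ a) (card≡# H) g∣a)
          (to x ⁻¹′) (∈⇒restrict H (⁻¹-closed (∈-resp-≈ H (≈-sym (from∘to x)) x∈H))))
      ; outside = λ x x∉H → let x⁻¹∉H = λ p → x∉H (inverse∈H x p) in
          trans (neighbours x) (trans (connection-outside a b (to x ⁻¹′) x⁻¹∉H)
            (regular-outside (restrict (S 𝒮₀)) closed₀ (perfect-row code)
              (subst (b ≤_) (card≡# H) b≤) (to x ⁻¹′) x⁻¹∉H))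
      }
      where
      neighbours : ∀ x → number (λ y → (y ∈? H) ×-dec (y ∙ x ⁻¹ ∈? S (connectionSet a b))) ≡
                    # (row (to x ⁻¹′) ∩ connection a b)
      neighbours x = trans (#-neighboursIn (connectionSet a b) x) (connectionSet-row a b (to x ⁻¹′))
      inverse∈H : ∀ x → T (restrict H (to x ⁻¹′)) → x ∈ H
      inverse∈H x p = restrict⇒∈ H (subst (T ∘ restrict H) (⁻¹-involutive (to x)) (∈⇒restrict H (⁻¹-closed p)))
      closed₀ : Closed (restrict (S 𝒮₀))
      closed₀ i p = ∈⇒restrict (S 𝒮₀) (S-⁻¹-closed 𝒮₀ p)

theoremA : ∀ {c ℓ} (G : Group c ℓ) (fin : Finite (Group.setoid G))
    (H : Subset (Group.setoid G)) → IsSubgroup G H → NonTrivial G H →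
    let open Finite fin using (card) in
    IsPerfectCodeOf G fin H ⇔
    (∀ (a b : ℕ) → a ≤ card H ∸ 1 → b ≤ card H → gcd 2 (card H ∸ 1) ∣ a →
    IsRegularSetOf G fin a b H)
theoremA G fin H H-subgroup H-nontrivial = mk⇔ (perfect⇒regular H H-subgroup)
  -- A perfect code is the case `a = 0`, `b = 1`: every number divides 0, and `H` contains the
  -- identity.
  (λ regular → regular 0 1 z≤n 1≤card (gcd 2 (Finite.card fin H ∸ 1) ∣0))
  where
  open Numbering G fin
  1≤card : 1 ≤ Finite.card fin H
  1≤card = subst (1 ≤_) (sym (card≡# H)) (∈⇒0<# (restrict H) 1#
    (∈⇒restrict H (IsSubgroup.ε-closed H-subgroup)))
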